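{- Let $k\ge2$ and $t\ge1$ be integers with $\gcd(k-1,tk+1)=1$, let $n=(k-1)(tk+1)$, $l=t(k-1)+1$, and identify $\mathbb{Z}_n$ with $\mathbb{Z}_{k-1}\times\mathbb{Z}_{tk+1}$. Assume $t(k-1)+k-2\ge 2$. Let $\mathcal{R}=\{R_1,\dots,R_l\}$ be an $(n,(k,\dots,k,k-1),k-1)$-PDF over $\mathbb{Z}_n$ with $|R_i|=k$ for $1\le i\le l-1$ and $R_l=\mathbb{Z}_{k-1}\times\{0\}$. Let $\mathcal{V}=\{V_1,\dots,V_{t(k-1)+k-2}\}$ be the family of disjoint subsets of $\mathbb{Z}_n$ defined by $V_i=R_i$ for $1\le i\le t(k-1)$ and $V_{t(k-1)+j}=\{(j,0)\}$ for $1\le j\le k-2$. Then $\mathcal{V}$ is a cyclic $$\bigl(n,\ t(k-1)+k-2,\ K=(k,\dots,k,1,\dots,1),\ n-1,\ (t+1)k^2-(t+3)k\bigr)\text{ -SWEDF},$$ where the element $1$ appears $k-2$ times and the element $k$ appears $t(k-1)$ times in $K$.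
   Context: PDF: a family $\{B_1,\dots,B_m\}$ of subsets of an Abelian group $G$ of order $n$ that partitions $G$, with $K=(|B_1|,\dots,|B_m|)$, is an $(n,K,\lambda)$-partitioned difference family (PDF) if each nonzero element of $G$ appears exactly $\lambda$ times in the multi-set union of the multi-sets $\{x-y: x,y\in B_i,\ x\ne y\}$, $1\le i\le m$. SWEDF: for multi-sets $B_1,B_2$ of elements of an Abelian group $G$ of order $n$, $D(B_1,B_2)$ is the multi-set $\{x-y : x\in B_1,\ y\in B_2\}$; $k\boxtimes B$ is the multi-set in which each element of $B$ is repeated $k$ times; unions are multi-set unions. Let $\mathcal{B}=\{B_i : 1\le i\le m\}$ be a family of pairwise disjoint nonempty subsets of $G$, $k_i=|B_i|$, $K=(k_1,\dots,k_m)$, $a=\sum_i k_i$, $\widetilde{k}=\mathrm{lcm}(k_1,\dots,k_m)$, $\widetilde{B}_i=\frac{\widetilde{k}}{k_i}\boxtimes B_i$. Then $\mathcal{B}$ is an $(n,m,K,a,\lambda)$-SWEDF (standard weighted external difference family), where $\lambda$ is a positive integer, if $\bigcup_{1\le i\ne j\le m}D(B_i,\widetilde{B}_j)=\lambda\boxtimes(G\setminus\{0\})$. A cyclic SWEDF is an SWEDF over a cyclic additive group. -}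

module Defs where

open import Algebra.Bundles using (AbelianGroup)
open import Algebra.Structures using (IsAbelianGroup)
import Algebra.Definitions.RawMonoid as RawMonoidDefinitions
open import Data.Fin.Base using (Fin; toℕ)
open import Data.Fin.Properties as Finₚ using (toℕ-fromℕ<; toℕ-injective; toℕ<n; toℕ≤n)
open import Data.List.Base as List using (List)
open import Data.List.Membership.Propositional using (_∈_)
open import Data.List.Membership.Propositional.Properties using (∈-allFin; ∈-cartesianProduct⁺)
open import Data.List.Relation.Binary.Permutation.Propositional using (_↭_)
open import Data.List.Relation.Unary.All using ([])
open import Data.List.Relation.Unary.AllPairs using ([]; _∷_)
open import Data.List.Relation.Unary.Unique.Propositional using (Unique)
open import Data.List.Relation.Unary.Unique.Propositional.Properties using (allFin⁺; cartesianProduct⁺)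
open import Data.Nat.Base using (ℕ; suc; _+_; _*_; _∸_; _≤_; _<_; NonZero; >-nonZero; >-nonZero⁻¹)
open import Data.Nat.DivMod using (_/_; _%_; _mod_; m%n<n; m<n⇒m%n≡m; n%n≡0; %-distribˡ-+; m%n%n≡m%n)
open import Data.Nat.LCM using (lcm)
open import Data.Nat.Properties
  using (+-comm; +-assoc; m∸n+n≡m; ∸-monoˡ-≤; m≤n+m)
open import Data.Product.Base using (_×_; _,_; proj₁; proj₂; ∃; uncurry)
open import Data.Product.Properties using (≡-dec)
open import Data.Vec.Functional as Vector using (Vector)
open import Function.Bundles using (_⇔_)
open import Level using (0ℓ)
open import Relation.Binary.Definitions using (DecidableEquality)
open import Relation.Binary.PropositionalEquality
  using (_≡_; _≢_; _≗_; refl; sym; trans; cong; cong₂; isEquivalence; module ≡-Reasoning)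
open import Relation.Nullary.Negation using (¬_)
open import Relation.Nullary.Decidable using (¬?)

record FiniteAbelianGroup : Set₁ where
  infixl 6 _∙_ _-_
  field
    Carrier        : Set
    _∙_            : Carrier → Carrier → Carrier
    ε              : Carrier
    _⁻¹            : Carrier → Carrier
    isAbelianGroup : IsAbelianGroup _≡_ _∙_ ε _⁻¹
    _≟_            : DecidableEquality Carrier
    elements       : List Carrier
    complete       : ∀ x → x ∈ elements
    unique         : Unique elements

  abelianGroup : AbelianGroup 0ℓ 0ℓ
  abelianGroup = record { isAbelianGroup = isAbelianGroup }

  order : ℕ
  order = List.length elements

  _-_ : Carrier → Carrier → Carrier
  x - y = x ∙ y ⁻¹

-- In a finite group natural-number multiples of a generator suffice.
IsCyclic : FiniteAbelianGroup → Set
IsCyclic G = ∃ λ g → ∀ x → ∃ λ j → j ×ᴳ g ≡ x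
  where
  open FiniteAbelianGroup G using (abelianGroup)
  open RawMonoidDefinitions (AbelianGroup.rawMonoid abelianGroup) renaming (_×_ to _×ᴳ_)

-- A subset is listed without repetition, in an arbitrary order; two subsets
-- are equal when they have the same members.
record Subset (A : Set) : Set where
  field
    members : List A
    unique  : Unique members

open Subset public using (members)

infix 4 _∈ₛ_

_∈ₛ_ : {A : Set} → A → Subset A → Set
x ∈ₛ B = x ∈ members B

∣_∣ : {A : Set} → Subset A → ℕ
∣ B ∣ = List.length (members B)

⁅_⁆ : {A : Set} → A → Subset A
⁅ x ⁆ = record { members = List.[ x ] ; unique = [] ∷ [] }

Family : Set → ℕ → Set
Family A m = Vector (Subset A) m

PairwiseDisjoint : {A : Set} {m : ℕ} → Family A m → Set
PairwiseDisjoint B = ∀ i j → i ≢ j → ∀ x → ¬ (x ∈ₛ B i × x ∈ₛ B j)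

-- A multiset is a list considered up to permutation.
Multiset : Set → Set
Multiset = List

infixr 7 _⊠_

_⊠_ : {A : Set} → ℕ → Multiset A → Multiset A
k ⊠ B = List.concatMap (List.replicate k) B

module _ (G : FiniteAbelianGroup) where
  open FiniteAbelianGroup G

  multiplicity : Carrier → Multiset Carrier → ℕ
  multiplicity g M = List.length (List.filter (g ≟_) M)

  D : Multiset Carrier → Multiset Carrier → Multiset Carrier
  D = List.cartesianProductWith _-_

  -- The multiset { x - y : x , y ∈ B , x ≠ y }.
  internalDifferences : Subset Carrier → Multiset Carrier
  internalDifferences B =
    List.map (uncurry _-_)
      (List.filter (λ (x , y) → ¬? (x ≟ y))
        (List.cartesianProduct (members B) (members B)))

  record IsPDF (n : ℕ) {m : ℕ} (K : Vector ℕ m) (ℓ : ℕ) (B : Family Carrier m) : Set where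
    field
      order-n     : order ≡ n
      nonempty    : ∀ i → NonZero ∣ B i ∣
      disjoint    : PairwiseDisjoint B
      covers      : ∀ x → ∃ λ i → x ∈ₛ B i
      sizes       : Vector.map ∣_∣ B ≗ K
      differences : ∀ g → g ≢ ε →
        multiplicity g (List.concat (List.tabulate λ i → internalDifferences (B i))) ≡ ℓ

  nonzeroElements : Multiset Carrier
  nonzeroElements = List.filter (λ x → ¬? (x ≟ ε)) elements

  lcmSizes : {m : ℕ} → Family Carrier m → ℕ
  lcmSizes B = Vector.foldr lcm 1 (Vector.map ∣_∣ B)

  weighted : {m : ℕ} (B : Family Carrier m) → (∀ i → NonZero ∣ B i ∣) → Fin m → Multiset Carrier
  weighted B nonempty i = (lcmSizes B / ∣ B i ∣) {{nonempty i}} ⊠ members (B i)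

  weightedExternalDifferences :
    {m : ℕ} (B : Family Carrier m) → (∀ i → NonZero ∣ B i ∣) → Multiset Carrier
  weightedExternalDifferences {m} B nonempty =
    List.concatMap (λ (i , j) → D (members (B i)) (weighted B nonempty j))
      (List.filter (λ (i , j) → ¬? (i Finₚ.≟ j))
        (List.cartesianProduct (List.allFin m) (List.allFin m)))

  record IsSWEDF (n m : ℕ) (K : Vector ℕ m) (a ℓ : ℕ) (B : Family Carrier m) : Set where
    field
      order-n     : order ≡ n
      nonempty    : ∀ i → NonZero ∣ B i ∣
      disjoint    : PairwiseDisjoint B
      sizes       : Vector.map ∣_∣ B ≗ K
      total       : Vector.foldr _+_ 0 (Vector.map ∣_∣ B) ≡ a
      ℓ-positive  : 0 < ℓ
      differences : weightedExternalDifferences B nonempty ↭ ℓ ⊠ nonzeroElements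

  IsCyclicSWEDF : (n m : ℕ) (K : Vector ℕ m) (a ℓ : ℕ) (B : Family Carrier m) → Set
  IsCyclicSWEDF n m K a ℓ B = IsCyclic G × IsSWEDF n m K a ℓ B

module _ (d : ℕ) .{{_ : NonZero d}} where

  private
    toℕ-mod : ∀ a → toℕ (a mod d) ≡ a % d
    toℕ-mod a = toℕ-fromℕ< (m%n<n a d)

    %⇒mod : ∀ {a b} → a % d ≡ b % d → a mod d ≡ b mod d
    %⇒mod {a} {b} eq = toℕ-injective (trans (toℕ-mod a) (trans eq (sym (toℕ-mod b))))

    mod-toℕ : ∀ (x : Fin d) → toℕ x mod d ≡ x
    mod-toℕ x = toℕ-injective (trans (toℕ-mod (toℕ x)) (m<n⇒m%n≡m (toℕ<n x)))

    _⊕_ : Fin d → Fin d → Fin d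
    x ⊕ y = (toℕ x + toℕ y) mod d

    𝟘 : Fin d
    𝟘 = 0 mod d

    ⊖_ : Fin d → Fin d
    ⊖ x = (d ∸ toℕ x) mod d

    %-absorbˡ : ∀ a b → (a % d + b) % d ≡ (a + b) % d
    %-absorbˡ a b = begin
      (a % d + b) % d          ≡⟨ %-distribˡ-+ (a % d) b d ⟩
      (a % d % d + b % d) % d  ≡⟨ cong (λ r → (r + b % d) % d) (m%n%n≡m%n a d) ⟩
      (a % d + b % d) % d      ≡⟨ %-distribˡ-+ a b d ⟨
      (a + b) % d              ∎
      where open ≡-Reasoning

    mod-⊕ : ∀ a y → (a mod d) ⊕ y ≡ (a + toℕ y) mod d
    mod-⊕ a y = %⇒mod (trans (cong (λ r → (r + toℕ y) % d) (toℕ-mod a)) (%-absorbˡ a (toℕ y)))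

    ⊕-comm : ∀ x y → x ⊕ y ≡ y ⊕ x
    ⊕-comm x y = cong (_mod d) (+-comm (toℕ x) (toℕ y))

    ⊕-assoc : ∀ x y z → (x ⊕ y) ⊕ z ≡ x ⊕ (y ⊕ z)
    ⊕-assoc x y z = begin
      (x ⊕ y) ⊕ z                        ≡⟨ mod-⊕ (toℕ x + toℕ y) z ⟩
      (toℕ x + toℕ y + toℕ z) mod d      ≡⟨ cong (_mod d) (+-assoc (toℕ x) (toℕ y) (toℕ z)) ⟩
      (toℕ x + (toℕ y + toℕ z)) mod d    ≡⟨ cong (_mod d) (+-comm (toℕ x) (toℕ y + toℕ z)) ⟩
      (toℕ y + toℕ z + toℕ x) mod d      ≡⟨ mod-⊕ (toℕ y + toℕ z) x ⟨
      (y ⊕ z) ⊕ x                        ≡⟨ ⊕-comm (y ⊕ z) x ⟩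
      x ⊕ (y ⊕ z)                        ∎
      where open ≡-Reasoning

    ⊕-identityˡ : ∀ x → 𝟘 ⊕ x ≡ x
    ⊕-identityˡ x = trans (mod-⊕ 0 x) (mod-toℕ x)

    ⊕-inverseˡ : ∀ x → (⊖ x) ⊕ x ≡ 𝟘
    ⊕-inverseˡ x = trans (mod-⊕ (d ∸ toℕ x) x)
      (trans (cong (_mod d) (m∸n+n≡m (toℕ≤n x)))
             (%⇒mod (trans (n%n≡0 d) (sym (m<n⇒m%n≡m (>-nonZero⁻¹ d))))))

  ℤmod : FiniteAbelianGroup
  ℤmod = record
    { Carrier        = Fin d
    ; _∙_            = _⊕_
    ; ε              = 𝟘
    ; _⁻¹            = ⊖_
    ; isAbelianGroup = record
      { isGroup = record
        { isMonoid = record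
          { isSemigroup = record
            { isMagma = record { isEquivalence = isEquivalence ; ∙-cong = cong₂ _⊕_ }
            ; assoc   = ⊕-assoc
            }
          ; identity = ⊕-identityˡ , λ x → trans (⊕-comm x 𝟘) (⊕-identityˡ x)
          }
        ; inverse = ⊕-inverseˡ , λ x → trans (⊕-comm x (⊖ x)) (⊕-inverseˡ x)
        ; ⁻¹-cong = cong ⊖_
        }
      ; comm = ⊕-comm
      }
    ; _≟_            = Finₚ._≟_
    ; elements       = List.allFin d
    ; complete       = ∈-allFin
    ; unique         = allFin⁺ d
    }

infixr 7 _⊗_

_⊗_ : FiniteAbelianGroup → FiniteAbelianGroup → FiniteAbelianGroup
G ⊗ H = record
  { Carrier        = G.Carrier × H.Carrier
  ; _∙_            = _∙_
  ; ε              = G.ε , H.ε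
  ; _⁻¹            = _⁻¹
  ; isAbelianGroup = record
    { isGroup = record
      { isMonoid = record
        { isSemigroup = record
          { isMagma = record { isEquivalence = isEquivalence ; ∙-cong = cong₂ _∙_ }
          ; assoc   = λ (a , b) (c , d) (e , f) → cong₂ _,_ (Gᴬ.assoc a c e) (Hᴬ.assoc b d f)
          }
        ; identity = (λ (a , b) → cong₂ _,_ (Gᴬ.identityˡ a) (Hᴬ.identityˡ b))
                   , (λ (a , b) → cong₂ _,_ (Gᴬ.identityʳ a) (Hᴬ.identityʳ b))
        }
      ; inverse = (λ (a , b) → cong₂ _,_ (Gᴬ.inverseˡ a) (Hᴬ.inverseˡ b))
                , (λ (a , b) → cong₂ _,_ (Gᴬ.inverseʳ a) (Hᴬ.inverseʳ b))
      ; ⁻¹-cong = cong _⁻¹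
      }
    ; comm = λ (a , b) (c , d) → cong₂ _,_ (Gᴬ.comm a c) (Hᴬ.comm b d)
    }
  ; _≟_            = ≡-dec G._≟_ H._≟_
  ; elements       = List.cartesianProduct G.elements H.elements
  ; complete       = λ (a , b) → ∈-cartesianProduct⁺ (G.complete a) (H.complete b)
  ; unique         = cartesianProduct⁺ G.unique H.unique
  }
  where
  module G  = FiniteAbelianGroup G
  module H  = FiniteAbelianGroup H
  module Gᴬ = AbelianGroup G.abelianGroup
  module Hᴬ = AbelianGroup H.abelianGroup

  _∙_ : G.Carrier × H.Carrier → G.Carrier × H.Carrier → G.Carrier × H.Carrier
  (a , b) ∙ (c , d) = a G.∙ c , b H.∙ d

  _⁻¹ : G.Carrier × H.Carrier → G.Carrier × H.Carrier
  (a , b) ⁻¹ = a G.⁻¹ , b H.⁻¹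

module _ (k t : ℕ) (2≤k : 2 ≤ k) where

  private instance
    k-1-nonZero : NonZero (k ∸ 1)
    k-1-nonZero = >-nonZero (∸-monoˡ-≤ 1 2≤k)

    tk+1-nonZero : NonZero (t * k + 1)
    tk+1-nonZero = >-nonZero (m≤n+m 1 (t * k))

  -- ℤ_n, in the form ℤ_{k-1} × ℤ_{tk+1}.
  ambientGroup : FiniteAbelianGroup
  ambientGroup = ℤmod (k ∸ 1) ⊗ ℤmod (t * k + 1)

  open FiniteAbelianGroup ambientGroup using (Carrier)

  class : ℕ → ℕ → Carrier
  class a b = a mod (k ∸ 1) , b mod (t * k + 1)

  -- B = ℤ_{k-1} × {0}.
  IsFirstFactor : Subset Carrier → Set
  IsFirstFactor B = ∀ x → x ∈ₛ B ⇔ proj₂ x ≡ 0 mod (t * k + 1)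

  -- The singletons are {(j , 0)} for 1 ≤ j ≤ k - 2, so the index is shifted by one.
  familyV : Family Carrier (t * (k ∸ 1) + 1) → Family Carrier (t * (k ∸ 1) + (k ∸ 2))
  familyV R = Vector.take (t * (k ∸ 1)) R Vector.++ λ j → ⁅ class (suc (toℕ j)) 0 ⁆

{-# OPTIONS --safe #-}
module Submission where

-- Write μ(g, M) for the multiplicity of g in M and ρ(B, g) = μ(g, D(B, B)).  The blocks
-- of 𝓥 partition G ∖ {0}, so summing over all pairs of blocks, diagonal included, each y
-- in block j contributes its weight w_j exactly once to the multiplicity of g, unless y = - g:
--   μ(g, ⋃_{i≠j} D(V_i, Ṽ_j)) + Σ_j w_j (ρ(V_j, g) + μ(- g, V_j)) = Σ_j w_j |V_j|.
-- The right-hand side is t k (k - 1) + k (k - 2) = λ + k.  For g ≠ 0 the correction term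
-- is k: the singletons have ρ = 0, the k-sets have total ρ equal to (k - 1) - (k - 1) h with
-- h = [g ∈ ℤ_{k-1} × {0}] by the PDF property, and - g lies in a block of weight
-- (1 - h) + k h.

open import Defs
open import Algebra.Bundles using (AbelianGroup)
import Algebra.Definitions.RawMonoid as RawMonoidDefinitions
import Algebra.Properties.AbelianGroup as AbelianGroupProperties
open import Data.Bool.Base using (if_then_else_)
open import Data.Fin.Base using (Fin; zero; suc; toℕ; _↑ˡ_; _↑ʳ_; splitAt)
open import Data.Fin.Properties as Finₚ
  using (splitAt-↑ˡ; splitAt-↑ʳ; splitAt⁻¹-↑ˡ; splitAt⁻¹-↑ʳ;
         toℕ-fromℕ<; toℕ-injective; toℕ<n; ↑ˡ-injective)
open import Data.List.Base as List
  using (List; []; _∷_; allFin; cartesianProduct; cartesianProductWith; concatMap; filter; length; tabulate)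
open import Data.List.Membership.Propositional using (_∈_)
open import Data.List.Membership.Propositional.Properties using (∈-allFin; ∈-∃++)
open import Data.List.Properties using (length-tabulate; map-tabulate)
open import Data.List.Relation.Binary.Permutation.Propositional using (_↭_; prep; ↭-refl; ↭-sym; ↭-trans)
open import Data.List.Relation.Binary.Permutation.Propositional.Properties using (shift)
open import Data.List.Relation.Unary.All as All using (All; []; _∷_)
open import Data.List.Relation.Unary.AllPairs using ([]; _∷_)
open import Data.List.Relation.Unary.Any using (here; there)
open import Data.List.Relation.Unary.Unique.Propositional using (Unique)
open import Data.List.Relation.Unary.Unique.Propositional.Properties using (allFin⁺)
open import Data.Nat.Base
  using (ℕ; zero; suc; _+_; _*_; _∸_; _^_; _≤_; _<_; z≤n; s≤s; NonZero; >-nonZero)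
open import Data.Nat.Coprimality using (gcd≡1⇒coprime; coprime-Bézout)
open import Data.Nat.Divisibility using (_∣_; ∣-antisym; ∣-trans; ∣-refl; 1∣_)
open import Data.Nat.DivMod
  using (_/_; _%_; _mod_; m%n<n; m<n⇒m%n≡m; %-distribˡ-+; [m+kn]%n≡m%n;
         n/n≡1; n/1≡n; /-congˡ; /-congʳ)
open import Data.Nat.GCD using (gcd; module Bézout)
open import Data.Nat.LCM using (lcm; lcm-least; m∣lcm[m,n]; n∣lcm[m,n])
open import Data.Nat.Properties
  using (+-comm; +-assoc; +-identityʳ; +-cancelʳ-≡; +-cancelˡ-≡; *-distribˡ-+; *-zeroʳ; *-identityˡ; *-identityʳ;
         m+n≡0⇒m≡0; m+n∸n≡m; m≤n+m; ∸-monoˡ-≤; 1+n≢0)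
open import Data.Nat.Solver using (module +-*-Solver)
open import Data.Product.Base using (_×_; _,_; proj₁; proj₂; ∃; uncurry)
open import Data.Sum.Base using (inj₁; inj₂)
open import Data.Vec.Functional as Vector using (Vector; replicate; _++_)
open import Data.Vec.Functional.Properties using (lookup-++ˡ; lookup-++ʳ)
open import Function.Base using (_∘_; id)
open import Function.Bundles using (Equivalence)
open import Relation.Binary.PropositionalEquality
  using (_≡_; _≢_; _≗_; refl; sym; trans; cong; cong₂; subst; module ≡-Reasoning)
open import Relation.Nullary.Decidable using (Dec; yes; no; does; ¬?)
open import Relation.Nullary.Negation using (¬_; contradiction)

open ≡-Reasoning

-- Finite sums

private variable
  A B : Set

∑ : List A → (A → ℕ) → ℕ
∑ []       f = 0
∑ (x ∷ xs) f = f x + ∑ xs f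

infix 8 ∑
syntax ∑ xs (λ x → e) = ∑[ x ∈ xs ] e

+-interchange : ∀ a b c d → (a + b) + (c + d) ≡ (a + c) + (b + d)
+-interchange = solve 4 (λ a b c d → (a :+ b) :+ (c :+ d) := (a :+ c) :+ (b :+ d)) refl
  where open +-*-Solver

∑-cong∈ : (xs : List A) {f g : A → ℕ} → (∀ {x} → x ∈ xs → f x ≡ g x) → ∑ xs f ≡ ∑ xs g
∑-cong∈ []       eq = refl
∑-cong∈ (x ∷ xs) eq = cong₂ _+_ (eq (here refl)) (∑-cong∈ xs (eq ∘ there))

∑-cong : (xs : List A) {f g : A → ℕ} → f ≗ g → ∑ xs f ≡ ∑ xs g
∑-cong xs eq = ∑-cong∈ xs (λ {x} _ → eq x)

∑-const : ∀ (xs : List A) c → (∑[ _ ∈ xs ] c) ≡ length xs * c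
∑-const []       c = refl
∑-const (x ∷ xs) c = cong (c +_) (∑-const xs c)

∑-zero : ∀ (xs : List A) {f : A → ℕ} → (∀ {x} → x ∈ xs → f x ≡ 0) → ∑ xs f ≡ 0
∑-zero xs eq = trans (∑-cong∈ xs eq) (trans (∑-const xs 0) (*-zeroʳ (length xs)))

∑-one : ∀ (xs : List A) {f : A → ℕ} → (∀ {x} → x ∈ xs → f x ≡ 1) → ∑ xs f ≡ length xs
∑-one xs eq = trans (∑-cong∈ xs eq) (trans (∑-const xs 1) (*-identityʳ (length xs)))

∑-distrib-+ : ∀ (xs : List A) f g → (∑[ x ∈ xs ] (f x + g x)) ≡ ∑ xs f + ∑ xs g
∑-distrib-+ []       f g = refl
∑-distrib-+ (x ∷ xs) f g =
  trans (cong (f x + g x +_) (∑-distrib-+ xs f g)) (+-interchange (f x) (g x) (∑ xs f) (∑ xs g))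

*-distribˡ-∑ : ∀ k (xs : List A) f → k * ∑ xs f ≡ ∑[ x ∈ xs ] (k * f x)
*-distribˡ-∑ k []       f = *-zeroʳ k
*-distribˡ-∑ k (x ∷ xs) f =
  trans (*-distribˡ-+ k (f x) (∑ xs f)) (cong (k * f x +_) (*-distribˡ-∑ k xs f))

∑-comm : ∀ (xs : List A) (ys : List B) (f : A → B → ℕ) →
  (∑[ x ∈ xs ] (∑[ y ∈ ys ] f x y)) ≡ ∑[ y ∈ ys ] (∑[ x ∈ xs ] f x y)
∑-comm []       ys f = sym (∑-zero ys (λ _ → refl))
∑-comm (x ∷ xs) ys f =
  trans (cong (∑ ys (f x) +_) (∑-comm xs ys f)) (sym (∑-distrib-+ ys (f x) _))

∑-++ : ∀ (xs ys : List A) f → ∑ (xs List.++ ys) f ≡ ∑ xs f + ∑ ys f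
∑-++ []       ys f = refl
∑-++ (x ∷ xs) ys f = trans (cong (f x +_) (∑-++ xs ys f)) (sym (+-assoc (f x) _ _))

∑-map : ∀ (h : A → B) xs f → ∑ (List.map h xs) f ≡ ∑ xs (f ∘ h)
∑-map h []       f = refl
∑-map h (x ∷ xs) f = cong (f (h x) +_) (∑-map h xs f)

∑-concatMap : ∀ (h : A → List B) xs f → ∑ (concatMap h xs) f ≡ ∑[ x ∈ xs ] ∑ (h x) f
∑-concatMap h []       f = refl
∑-concatMap h (x ∷ xs) f =
  trans (∑-++ (h x) (concatMap h xs) f) (cong (∑ (h x) f +_) (∑-concatMap h xs f))

∑-cartesianProductWith : ∀ {C : Set} (h : A → B → C) xs ys f →
  ∑ (cartesianProductWith h xs ys) f ≡ ∑[ x ∈ xs ] (∑[ y ∈ ys ] f (h x y))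
∑-cartesianProductWith h []       ys f = refl
∑-cartesianProductWith h (x ∷ xs) ys f = trans
  (∑-++ (List.map (h x) ys) _ f)
  (cong₂ _+_ (∑-map (h x) ys f) (∑-cartesianProductWith h xs ys f))

∑-replicate : ∀ k (x : A) f → ∑ (List.replicate k x) f ≡ k * f x
∑-replicate zero    x f = refl
∑-replicate (suc k) x f = cong (f x +_) (∑-replicate k x f)

∑-⊠ : ∀ k (xs : List A) f → ∑ (k ⊠ xs) f ≡ k * ∑ xs f
∑-⊠ k xs f = begin
  ∑ (k ⊠ xs) f                          ≡⟨ ∑-concatMap (List.replicate k) xs f ⟩
  ∑[ x ∈ xs ] ∑ (List.replicate k x) f  ≡⟨ ∑-cong xs (λ x → ∑-replicate k x f) ⟩
  ∑[ x ∈ xs ] (k * f x)                 ≡⟨ *-distribˡ-∑ k xs f ⟨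
  k * ∑ xs f                            ∎

∑-single : ∀ {xs : List A} {x f} → Unique xs → x ∈ xs → (∀ {y} → y ≢ x → f y ≡ 0) → ∑ xs f ≡ f x
∑-single {xs = x ∷ xs} {f = f} (x∉xs ∷ _) (here refl) off = trans
  (cong (f x +_) (∑-zero xs λ y∈xs → off λ y≡x → All.lookup x∉xs y∈xs (sym y≡x)))
  (+-identityʳ (f x))
∑-single {xs = _ ∷ xs} (x∉xs ∷ u) (there x∈xs) off =
  cong₂ _+_ (off (All.lookup x∉xs x∈xs)) (∑-single u x∈xs off)

∑-tabulate : ∀ {n} (h : Fin n → A) f → ∑ (tabulate h) f ≡ ∑ (allFin n) (f ∘ h)
∑-tabulate {n = n} h f = trans (cong (λ xs → ∑ xs f) (sym (map-tabulate id h))) (∑-map h (allFin n) f)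

∑-suc : ∀ {n} (f : Fin (suc n) → ℕ) → ∑ (allFin (suc n)) f ≡ f zero + ∑ (allFin n) (f ∘ suc)
∑-suc f = cong (f zero +_) (∑-tabulate suc f)

∑-splitAt : ∀ m {n} (f : Fin (m + n) → ℕ) →
  ∑ (allFin (m + n)) f ≡ ∑[ i ∈ allFin m ] f (i ↑ˡ n) + ∑[ j ∈ allFin n ] f (m ↑ʳ j)
∑-splitAt zero        f = refl
∑-splitAt (suc m) {n} f = begin
  ∑ (allFin (suc m + n)) f                       ≡⟨ ∑-suc f ⟩
  f zero + ∑ (allFin (m + n)) (f ∘ suc)          ≡⟨ cong (f zero +_) (∑-splitAt m (f ∘ suc)) ⟩
  f zero + (∑ (allFin m) (f ∘ suc ∘ (_↑ˡ n)) + r) ≡⟨ +-assoc (f zero) _ r ⟨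
  f zero + ∑ (allFin m) (f ∘ suc ∘ (_↑ˡ n)) + r  ≡⟨ cong (_+ r) (∑-suc (f ∘ (_↑ˡ n))) ⟨
  ∑ (allFin (suc m)) (f ∘ (_↑ˡ n)) + r           ∎
  where r = ∑ (allFin n) (f ∘ suc ∘ (m ↑ʳ_))

foldr-+≡∑ : ∀ {n} (v : Vector ℕ n) → Vector.foldr _+_ 0 v ≡ ∑ (allFin n) v
foldr-+≡∑ {zero}  v = refl
foldr-+≡∑ {suc n} v = trans (cong (v zero +_) (foldr-+≡∑ (v ∘ suc))) (sym (∑-suc v))

length-allFin : ∀ n → length (allFin n) ≡ n
length-allFin n = length-tabulate {n = n} id

∑-allFin-const : ∀ n c → (∑[ _ ∈ allFin n ] c) ≡ n * c
∑-allFin-const n c = trans (∑-const (allFin n) c) (cong (_* c) (length-allFin n))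

𝟙 : {P : Set} → Dec P → ℕ
𝟙 P? = if does P? then 1 else 0

𝟙-yes : {P : Set} (P? : Dec P) → P → 𝟙 P? ≡ 1
𝟙-yes (yes _) p = refl
𝟙-yes (no ¬p) p = contradiction p ¬p

𝟙-no : {P : Set} (P? : Dec P) → ¬ P → 𝟙 P? ≡ 0
𝟙-no (yes p) ¬p = contradiction p ¬p
𝟙-no (no _)  ¬p = refl

𝟙-⇔ : {P Q : Set} (P? : Dec P) (Q? : Dec Q) → (P → Q) → (Q → P) → 𝟙 P? ≡ 𝟙 Q?
𝟙-⇔ (yes p) Q? to from = sym (𝟙-yes Q? (to p))
𝟙-⇔ (no ¬p) Q? to from = sym (𝟙-no Q? (¬p ∘ from))

𝟙-¬ : {P : Set} (P? : Dec P) (x : ℕ) → 𝟙 (¬? P?) * x + 𝟙 P? * x ≡ x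
𝟙-¬ (yes _) x = +-identityʳ x
𝟙-¬ (no _)  x = trans (+-identityʳ _) (+-identityʳ x)

∑-filter : ∀ {P : A → Set} (P? : ∀ x → Dec (P x)) xs f →
  ∑ (filter P? xs) f ≡ ∑[ x ∈ xs ] (𝟙 (P? x) * f x)
∑-filter P? []       f = refl
∑-filter P? (x ∷ xs) f with P? x
... | yes _ = cong₂ _+_ (sym (+-identityʳ (f x))) (∑-filter P? xs f)
... | no _  = ∑-filter P? xs f

length-filter≡∑ : ∀ {P : A → Set} (P? : ∀ x → Dec (P x)) xs →
  length (filter P? xs) ≡ ∑[ x ∈ xs ] 𝟙 (P? x)
length-filter≡∑ P? []       = refl
length-filter≡∑ P? (x ∷ xs) with P? x
... | yes _ = cong suc (length-filter≡∑ P? xs)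
... | no _  = length-filter≡∑ P? xs

-- The excluded term is added back on the left, so that truncated subtraction never enters.
∑-off-diagonal : ∀ {n} (i : Fin n) f →
  ∑[ j ∈ allFin n ] (𝟙 (¬? (i Finₚ.≟ j)) * f j) + f i ≡ ∑ (allFin n) f
∑-off-diagonal {n} i f = begin
  s + f i
    ≡⟨ cong (s +_) diagonal ⟨
  s + ∑[ j ∈ allFin n ] (𝟙 (i Finₚ.≟ j) * f j)
    ≡⟨ ∑-distrib-+ (allFin n) _ _ ⟨
  ∑[ j ∈ allFin n ] (𝟙 (¬? (i Finₚ.≟ j)) * f j + 𝟙 (i Finₚ.≟ j) * f j)
    ≡⟨ ∑-cong (allFin n) (λ j → 𝟙-¬ (i Finₚ.≟ j) (f j)) ⟩
  ∑ (allFin n) f ∎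
  where
  s = ∑[ j ∈ allFin n ] (𝟙 (¬? (i Finₚ.≟ j)) * f j)

  diagonal : ∑[ j ∈ allFin n ] (𝟙 (i Finₚ.≟ j) * f j) ≡ f i
  diagonal = begin
    ∑[ j ∈ allFin n ] (𝟙 (i Finₚ.≟ j) * f j)
      ≡⟨ ∑-single (allFin⁺ n) (∈-allFin i) (λ {j} j≢i → cong (_* f j) (𝟙-no (i Finₚ.≟ j) (j≢i ∘ sym))) ⟩
    𝟙 (i Finₚ.≟ i) * f i  ≡⟨ cong (_* f i) (𝟙-yes (i Finₚ.≟ i) refl) ⟩
    1 * f i               ≡⟨ *-identityˡ (f i) ⟩
    f i                   ∎

-- Since `k` is a common multiple, the lcm divides it; since `k` is also an entry, it divides the
-- lcm.
foldr-lcm≡ : ∀ {n} (v : Vector ℕ n) {k} → (∀ i → v i ∣ k) → ∀ i → v i ≡ k → Vector.foldr lcm 1 v ≡ k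
foldr-lcm≡ v {k} v∣k i vi≡k = ∣-antisym (least v v∣k) (subst (_∣ Vector.foldr lcm 1 v) vi≡k (upper v i))
  where
  least : ∀ {n} (v : Vector ℕ n) → (∀ i → v i ∣ k) → Vector.foldr lcm 1 v ∣ k
  least {zero}  v v∣k = 1∣ k
  least {suc n} v v∣k = lcm-least (v∣k zero) (least (v ∘ suc) (v∣k ∘ suc))

  upper : ∀ {n} (v : Vector ℕ n) i → v i ∣ Vector.foldr lcm 1 v
  upper v zero    = m∣lcm[m,n] (v zero) _
  upper v (suc i) = ∣-trans (upper (v ∘ suc) i) (n∣lcm[m,n] (v zero) _)

-- Multiplicities in a finite Abelian group

module Multiplicity (G : FiniteAbelianGroup) where
  open FiniteAbelianGroup G
  open AbelianGroup abelianGroup using (assoc; identityˡ; identityʳ; inverseˡ; inverseʳ; comm)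
  open AbelianGroupProperties abelianGroup using (inverseʳ-unique)

  μ : Carrier → Multiset Carrier → ℕ
  μ = multiplicity G

  -- Turns counting into summation of indicators, so that double counting becomes an exchange of
  -- sums.
  μ≡∑ : ∀ g M → μ g M ≡ ∑[ x ∈ M ] 𝟙 (g ≟ x)
  μ≡∑ g M = length-filter≡∑ (g ≟_) M

  μ-∉ : ∀ {g M} → ¬ g ∈ M → μ g M ≡ 0
  μ-∉ {g} {M} g∉M = trans (μ≡∑ g M) (∑-zero M λ {x} x∈M → 𝟙-no (g ≟ x) λ { refl → g∉M x∈M })

  μ-∈ : ∀ {g M} → Unique M → g ∈ M → μ g M ≡ 1
  μ-∈ {g} {M} u g∈M = begin
    μ g M                 ≡⟨ μ≡∑ g M ⟩
    ∑[ x ∈ M ] 𝟙 (g ≟ x)  ≡⟨ ∑-single u g∈M (λ {x} x≢g → 𝟙-no (g ≟ x) (x≢g ∘ sym)) ⟩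
    𝟙 (g ≟ g)             ≡⟨ 𝟙-yes (g ≟ g) refl ⟩
    1                     ∎

  μ≢0⇒∈ : ∀ {g} M → μ g M ≢ 0 → g ∈ M
  μ≢0⇒∈ {g} []      μ≢0 = contradiction refl μ≢0
  μ≢0⇒∈ {g} (x ∷ M) μ≢0 with g ≟ x
  ... | yes g≡x = here g≡x
  ... | no _    = there (μ≢0⇒∈ M μ≢0)

  μ-∷ : ∀ g x M → μ g (x ∷ M) ≡ 𝟙 (g ≟ x) + μ g M
  μ-∷ g x M = trans (μ≡∑ g (x ∷ M)) (cong (𝟙 (g ≟ x) +_) (sym (μ≡∑ g M)))

  μ-∷-≢0 : ∀ x M → μ x (x ∷ M) ≢ 0
  μ-∷-≢0 x M μ≡0 = 1+n≢0 (begin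
    1 + μ x M          ≡⟨ cong (_+ μ x M) (𝟙-yes (x ≟ x) refl) ⟨
    𝟙 (x ≟ x) + μ x M  ≡⟨ μ-∷ x x M ⟨
    μ x (x ∷ M)        ≡⟨ μ≡0 ⟩
    0                  ∎)

  μ-shift : ∀ g x M N → μ g (M List.++ x ∷ N) ≡ 𝟙 (g ≟ x) + μ g (M List.++ N)
  μ-shift g x []      N = μ-∷ g x N
  μ-shift g x (y ∷ M) N = begin
    μ g (y ∷ M List.++ x ∷ N)                      ≡⟨ μ-∷ g y _ ⟩
    𝟙 (g ≟ y) + μ g (M List.++ x ∷ N)              ≡⟨ cong (𝟙 (g ≟ y) +_) (μ-shift g x M N) ⟩
    𝟙 (g ≟ y) + (𝟙 (g ≟ x) + μ g (M List.++ N))    ≡⟨ +-assoc (𝟙 (g ≟ y)) _ _ ⟨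
    𝟙 (g ≟ y) + 𝟙 (g ≟ x) + μ g (M List.++ N)      ≡⟨ cong (_+ μ g (M List.++ N)) (+-comm (𝟙 (g ≟ y)) _) ⟩
    𝟙 (g ≟ x) + 𝟙 (g ≟ y) + μ g (M List.++ N)      ≡⟨ +-assoc (𝟙 (g ≟ x)) _ _ ⟩
    𝟙 (g ≟ x) + (𝟙 (g ≟ y) + μ g (M List.++ N))    ≡⟨ cong (𝟙 (g ≟ x) +_) (μ-∷ g y _) ⟨
    𝟙 (g ≟ x) + μ g (y ∷ M List.++ N)              ∎

  -- Induction on `M`: its head `x` has nonzero multiplicity in `N`, so `N` splits around an
  -- occurrence of `x`, and deleting `x` on both sides keeps all multiplicities equal. This reduces
  -- an identity of multisets to a count for each `g`.
  equal-μ⇒↭ : ∀ M N → (∀ g → μ g M ≡ μ g N) → M ↭ N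
  equal-μ⇒↭ []      []      eq = ↭-refl
  equal-μ⇒↭ []      (y ∷ N) eq = contradiction (sym (eq y)) (μ-∷-≢0 y N)
  equal-μ⇒↭ (x ∷ M) N       eq
    with as , bs , refl ← ∈-∃++ (μ≢0⇒∈ N (μ-∷-≢0 x M ∘ trans (eq x)))
    = ↭-trans (prep x (equal-μ⇒↭ M (as List.++ bs) tails)) (↭-sym (shift x as bs))
    where
    tails : ∀ g → μ g M ≡ μ g (as List.++ bs)
    tails g = +-cancelˡ-≡ (𝟙 (g ≟ x)) _ _ (begin
      𝟙 (g ≟ x) + μ g M                   ≡⟨ μ-∷ g x M ⟨
      μ g (x ∷ M)                         ≡⟨ eq g ⟩
      μ g (as List.++ x ∷ bs)             ≡⟨ μ-shift g x as bs ⟩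
      𝟙 (g ≟ x) + μ g (as List.++ bs)     ∎)

  μ-⊠ : ∀ g k M → μ g (k ⊠ M) ≡ k * μ g M
  μ-⊠ g k M = begin
    μ g (k ⊠ M)               ≡⟨ μ≡∑ g (k ⊠ M) ⟩
    ∑ (k ⊠ M) (λ x → 𝟙 (g ≟ x))  ≡⟨ ∑-⊠ k M _ ⟩
    k * ∑ M (λ x → 𝟙 (g ≟ x))    ≡⟨ cong (k *_) (μ≡∑ g M) ⟨
    k * μ g M                 ∎

  μ-concat-tabulate : ∀ {n} g (h : Fin n → Multiset Carrier) →
    μ g (List.concat (tabulate h)) ≡ ∑[ i ∈ allFin n ] μ g (h i)
  μ-concat-tabulate {n} g h = begin
    μ g (List.concat (tabulate h))                    ≡⟨ cong (μ g ∘ List.concat) (map-tabulate id h) ⟨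
    μ g (concatMap h (allFin n))                      ≡⟨ μ≡∑ g (concatMap h (allFin n)) ⟩
    ∑ (concatMap h (allFin n)) (λ x → 𝟙 (g ≟ x))      ≡⟨ ∑-concatMap h (allFin n) _ ⟩
    ∑[ i ∈ allFin n ] (∑[ x ∈ h i ] 𝟙 (g ≟ x))        ≡⟨ ∑-cong (allFin n) (λ i → μ≡∑ g (h i)) ⟨
    ∑[ i ∈ allFin n ] μ g (h i)                       ∎

  μ-nonzeroElements : ∀ {g} → g ≢ ε → μ g (nonzeroElements G) ≡ 1
  μ-nonzeroElements {g} g≢ε = begin
    μ g (nonzeroElements G)                            ≡⟨ μ≡∑ g (nonzeroElements G) ⟩
    ∑ (nonzeroElements G) (λ x → 𝟙 (g ≟ x))            ≡⟨ ∑-filter (λ x → ¬? (x ≟ ε)) elements _ ⟩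
    ∑[ x ∈ elements ] (𝟙 (¬? (x ≟ ε)) * 𝟙 (g ≟ x))    ≡⟨ ∑-cong elements pointwise ⟩
    ∑[ x ∈ elements ] 𝟙 (g ≟ x)                        ≡⟨ μ≡∑ g elements ⟨
    μ g elements                                       ≡⟨ μ-∈ unique (complete g) ⟩
    1                                                  ∎
    where
    pointwise : ∀ x → 𝟙 (¬? (x ≟ ε)) * 𝟙 (g ≟ x) ≡ 𝟙 (g ≟ x)
    pointwise x with x ≟ ε
    ... | yes refl = sym (𝟙-no (g ≟ ε) g≢ε)
    ... | no _     = +-identityʳ _

  μ-nonzeroElements-ε : μ ε (nonzeroElements G) ≡ 0
  μ-nonzeroElements-ε = begin
    μ ε (nonzeroElements G)                            ≡⟨ μ≡∑ ε (nonzeroElements G) ⟩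
    ∑ (nonzeroElements G) (λ x → 𝟙 (ε ≟ x))            ≡⟨ ∑-filter (λ x → ¬? (x ≟ ε)) elements _ ⟩
    ∑[ x ∈ elements ] (𝟙 (¬? (x ≟ ε)) * 𝟙 (ε ≟ x))    ≡⟨ ∑-zero elements (λ {x} _ → pointwise x) ⟩
    0                                                  ∎
    where
    pointwise : ∀ x → 𝟙 (¬? (x ≟ ε)) * 𝟙 (ε ≟ x) ≡ 0
    pointwise x with x ≟ ε
    ... | yes _   = refl
    ... | no x≢ε  = trans (+-identityʳ _) (𝟙-no (ε ≟ x) (x≢ε ∘ sym))

  -- Counting differences

  g≡x-y⇒g∙y≡x : ∀ {g x y} → g ≡ x - y → g ∙ y ≡ x
  g≡x-y⇒g∙y≡x {x = x} {y} refl =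
    trans (assoc x (y ⁻¹) y) (trans (cong (x ∙_) (inverseˡ y)) (identityʳ x))

  g∙y≡x⇒g≡x-y : ∀ {g x y} → g ∙ y ≡ x → g ≡ x - y
  g∙y≡x⇒g≡x-y {g} {y = y} refl =
    sym (trans (assoc g y (y ⁻¹)) (trans (cong (g ∙_) (inverseʳ y)) (identityʳ g)))

  -- For given `g` and `y` the equation `g ≡ x - y` has the single solution `x ≡ g ∙ y`, so
  -- representations of `g` are counted by their second component.
  μ-differences : ∀ g M N →
    (∑[ x ∈ M ] (∑[ y ∈ N ] 𝟙 (g ≟ (x - y)))) ≡ ∑[ y ∈ N ] μ (g ∙ y) M
  μ-differences g M N = begin
    ∑[ x ∈ M ] (∑[ y ∈ N ] 𝟙 (g ≟ (x - y)))  ≡⟨ ∑-comm M N _ ⟩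
    ∑[ y ∈ N ] (∑[ x ∈ M ] 𝟙 (g ≟ (x - y)))  ≡⟨ ∑-cong N (λ y → ∑-cong M λ x →
      𝟙-⇔ (g ≟ (x - y)) ((g ∙ y) ≟ x) g≡x-y⇒g∙y≡x g∙y≡x⇒g≡x-y) ⟩
    ∑[ y ∈ N ] (∑[ x ∈ M ] 𝟙 ((g ∙ y) ≟ x))  ≡⟨ ∑-cong N (λ y → μ≡∑ (g ∙ y) M) ⟨
    ∑[ y ∈ N ] μ (g ∙ y) M                   ∎

  μ-D : ∀ g M N → μ g (D G M N) ≡ ∑[ y ∈ N ] μ (g ∙ y) M
  μ-D g M N = trans (μ≡∑ g (D G M N)) (trans (∑-cartesianProductWith _-_ M N _) (μ-differences g M N))

  -- The autocorrelation of `B`. By `μ-D` it is the multiplicity of `g` in `D(B, B)`, diagonal pairs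
  -- included.
  ρ : Subset Carrier → Carrier → ℕ
  ρ B g = ∑[ y ∈ members B ] μ (g ∙ y) (members B)

  ρ-ε : ∀ B → ρ B ε ≡ ∣ B ∣
  ρ-ε B = ∑-one (members B) λ {y} y∈B →
    trans (cong (λ z → μ z (members B)) (identityˡ y)) (μ-∈ (Subset.unique B) y∈B)

  ρ-singleton : ∀ x {g} → g ≢ ε → ρ ⁅ x ⁆ g ≡ 0
  ρ-singleton x {g} g≢ε = trans (+-identityʳ _) (μ-∉ {M = x ∷ []} λ where
    (here g∙x≡x) → g≢ε (trans (g∙y≡x⇒g≡x-y g∙x≡x) (inverseʳ x)))

  -- A pair with `x ≡ y` has difference `ε`, so for `g ≢ ε` removing such pairs changes nothing.
  μ-internalDifferences : ∀ B {g} → g ≢ ε → μ g (internalDifferences G B) ≡ ρ B g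
  μ-internalDifferences B {g} g≢ε = begin
    μ g (internalDifferences G B)
      ≡⟨ μ≡∑ g (internalDifferences G B) ⟩
    ∑ (internalDifferences G B) (λ z → 𝟙 (g ≟ z))
      ≡⟨ ∑-map (uncurry _-_) (filter distinct? M×M) _ ⟩
    ∑ (filter distinct? M×M) (λ (x , y) → 𝟙 (g ≟ (x - y)))
      ≡⟨ ∑-filter distinct? M×M _ ⟩
    ∑ M×M (λ (x , y) → 𝟙 (¬? (x ≟ y)) * 𝟙 (g ≟ (x - y)))
      ≡⟨ ∑-cong M×M pointwise ⟩
    ∑ M×M (λ (x , y) → 𝟙 (g ≟ (x - y)))
      ≡⟨ ∑-cartesianProductWith _,_ M M _ ⟩
    ∑[ x ∈ M ] (∑[ y ∈ M ] 𝟙 (g ≟ (x - y)))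
      ≡⟨ μ-differences g M M ⟩
    ρ B g ∎
    where
    M   = members B
    M×M = cartesianProduct M M

    distinct? : (p : Carrier × Carrier) → Dec (¬ proj₁ p ≡ proj₂ p)
    distinct? (x , y) = ¬? (x ≟ y)

    pointwise : ∀ ((x , y) : Carrier × Carrier) → 𝟙 (¬? (x ≟ y)) * 𝟙 (g ≟ (x - y)) ≡ 𝟙 (g ≟ (x - y))
    pointwise (x , y) with x ≟ y
    ... | yes refl = sym (𝟙-no (g ≟ (x - x)) λ g≡x-x → g≢ε (trans g≡x-x (inverseʳ x)))
    ... | no _     = +-identityʳ _

  -- Multiplicities summed over a family

  partition-μ : ∀ {m} (B : Family Carrier m) → PairwiseDisjoint B → (∀ x → ∃ λ i → x ∈ₛ B i) →
    ∀ g → ∑[ i ∈ allFin m ] μ g (members (B i)) ≡ 1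
  partition-μ {m} B disjoint covers g with i , g∈Bi ← covers g = trans
    (∑-single (allFin⁺ m) (∈-allFin i) λ {j} j≢i → μ-∉ λ g∈Bj → disjoint j i j≢i g (g∈Bj , g∈Bi))
    (μ-∈ (Subset.unique (B i)) g∈Bi)

  weight : ∀ {m} (B : Family Carrier m) → (∀ i → NonZero ∣ B i ∣) → Fin m → ℕ
  weight B nonempty i = (lcmSizes G B / ∣ B i ∣) {{nonempty i}}

  -- Adding the diagonal pairs completes the sum to all pairs `(i , j)`. The weight depends on `j`
  -- alone, so the sum over `i` moves inside, where it counts the blocks containing `g ∙ y`.
  μ-weightedExternalDifferences : ∀ {m} (B : Family Carrier m) (nonempty : ∀ i → NonZero ∣ B i ∣) g →
    μ g (weightedExternalDifferences G B nonempty) + ∑[ j ∈ allFin m ] (weight B nonempty j * ρ (B j) g)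
      ≡ ∑[ j ∈ allFin m ] (weight B nonempty j *
          (∑[ y ∈ members (B j) ] (∑[ i ∈ allFin m ] μ (g ∙ y) (members (B i)))))
  μ-weightedExternalDifferences {m} B nonempty g = begin
    μ g (weightedExternalDifferences G B nonempty) + ∑[ i ∈ F ] c i i
      ≡⟨ cong (_+ ∑[ i ∈ F ] c i i) off-diagonal ⟩
    ∑[ i ∈ F ] (∑[ j ∈ F ] (𝟙 (¬? (i Finₚ.≟ j)) * c i j)) + ∑[ i ∈ F ] c i i
      ≡⟨ ∑-distrib-+ F _ _ ⟨
    ∑[ i ∈ F ] (∑[ j ∈ F ] (𝟙 (¬? (i Finₚ.≟ j)) * c i j) + c i i)
      ≡⟨ ∑-cong F (λ i → ∑-off-diagonal i (c i)) ⟩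
    ∑[ i ∈ F ] (∑[ j ∈ F ] c i j)
      ≡⟨ ∑-comm F F c ⟩
    ∑[ j ∈ F ] (∑[ i ∈ F ] c i j)
      ≡⟨ ∑-cong F (λ j → *-distribˡ-∑ (weight B nonempty j) F _) ⟨
    ∑[ j ∈ F ] (weight B nonempty j * (∑[ i ∈ F ] (∑[ y ∈ members (B j) ] μ (g ∙ y) (members (B i)))))
      ≡⟨ ∑-cong F (λ j → cong (weight B nonempty j *_) (∑-comm F (members (B j)) _)) ⟩
    ∑[ j ∈ F ] (weight B nonempty j * (∑[ y ∈ members (B j) ] (∑[ i ∈ F ] μ (g ∙ y) (members (B i))))) ∎
    where
    F = allFin m

    -- The multiplicity of `g` in `D(B i, W j)`, with the repetition of `B j` pulled out as a
    -- factor.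
    c : Fin m → Fin m → ℕ
    c i j = weight B nonempty j * (∑[ y ∈ members (B j) ] μ (g ∙ y) (members (B i)))

    distinct? : (p : Fin m × Fin m) → Dec (¬ proj₁ p ≡ proj₂ p)
    distinct? (i , j) = ¬? (i Finₚ.≟ j)

    W = weighted G B nonempty

    off-diagonal : μ g (weightedExternalDifferences G B nonempty)
      ≡ ∑[ i ∈ F ] (∑[ j ∈ F ] (𝟙 (¬? (i Finₚ.≟ j)) * c i j))
    off-diagonal = begin
      μ g (weightedExternalDifferences G B nonempty)
        ≡⟨ μ≡∑ g (weightedExternalDifferences G B nonempty) ⟩
      ∑ (weightedExternalDifferences G B nonempty) (λ z → 𝟙 (g ≟ z))
        ≡⟨ ∑-concatMap _ (filter distinct? (cartesianProduct F F)) _ ⟩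
      ∑ (filter distinct? (cartesianProduct F F)) (λ (i , j) → ∑ (D G (members (B i)) (W j)) (λ z → 𝟙 (g ≟ z)))
        ≡⟨ ∑-filter distinct? (cartesianProduct F F) _ ⟩
      ∑ (cartesianProduct F F) (λ (i , j) → 𝟙 (¬? (i Finₚ.≟ j)) * ∑ (D G (members (B i)) (W j)) (λ z → 𝟙 (g ≟ z)))
        ≡⟨ ∑-cartesianProductWith _,_ F F _ ⟩
      ∑[ i ∈ F ] (∑[ j ∈ F ] (𝟙 (¬? (i Finₚ.≟ j)) * ∑ (D G (members (B i)) (W j)) (λ z → 𝟙 (g ≟ z))))
        ≡⟨ ∑-cong F (λ i → ∑-cong F λ j → cong (𝟙 (¬? (i Finₚ.≟ j)) *_) (begin
          ∑ (D G (members (B i)) (W j)) (λ z → 𝟙 (g ≟ z))  ≡⟨ μ≡∑ g (D G (members (B i)) (W j)) ⟨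
          μ g (D G (members (B i)) (W j))                  ≡⟨ μ-D g (members (B i)) (W j) ⟩
          ∑[ y ∈ W j ] μ (g ∙ y) (members (B i))           ≡⟨ ∑-⊠ (weight B nonempty j) (members (B j)) _ ⟩
          c i j                                            ∎)) ⟩
      ∑[ i ∈ F ] (∑[ j ∈ F ] (𝟙 (¬? (i Finₚ.≟ j)) * c i j)) ∎

  -- If the family partitions G ∖ {0}, then y + g lies in a unique block for each y ≠ - g.
  near-complete-μ : ∀ {m} (B : Family Carrier m) (nonempty : ∀ i → NonZero ∣ B i ∣) →
    (∀ z → ∑[ i ∈ allFin m ] μ z (members (B i)) + 𝟙 (z ≟ ε) ≡ 1) → ∀ g →
    μ g (weightedExternalDifferences G B nonempty)
      + ∑[ j ∈ allFin m ] (weight B nonempty j * (ρ (B j) g + μ (g ⁻¹) (members (B j))))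
      ≡ ∑[ j ∈ allFin m ] (weight B nonempty j * ∣ B j ∣)
  near-complete-μ {m} B nonempty near-complete g = begin
    μ g wed + ∑[ j ∈ F ] (w j * (ρ (B j) g + μ (g ⁻¹) (members (B j))))
      ≡⟨ cong (μ g wed +_) (trans (∑-cong F λ j → *-distribˡ-+ (w j) _ _) (∑-distrib-+ F _ _)) ⟩
    μ g wed + (∑[ j ∈ F ] (w j * ρ (B j) g) + ∑[ j ∈ F ] (w j * μ (g ⁻¹) (members (B j))))
      ≡⟨ +-assoc (μ g wed) _ _ ⟨
    μ g wed + ∑[ j ∈ F ] (w j * ρ (B j) g) + ∑[ j ∈ F ] (w j * μ (g ⁻¹) (members (B j)))
      ≡⟨ cong (_+ ∑[ j ∈ F ] (w j * μ (g ⁻¹) (members (B j)))) (μ-weightedExternalDifferences B nonempty g) ⟩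
    ∑[ j ∈ F ] (w j * (∑[ y ∈ members (B j) ] s (g ∙ y))) + ∑[ j ∈ F ] (w j * μ (g ⁻¹) (members (B j)))
      ≡⟨ ∑-distrib-+ F _ _ ⟨
    ∑[ j ∈ F ] (w j * (∑[ y ∈ members (B j) ] s (g ∙ y)) + w j * μ (g ⁻¹) (members (B j)))
      ≡⟨ ∑-cong F (λ j → trans (sym (*-distribˡ-+ (w j) _ _)) (cong (w j *_) (block (members (B j))))) ⟩
    ∑[ j ∈ F ] (w j * ∣ B j ∣) ∎
    where
    F   = allFin m
    w   = weight B nonempty
    wed = weightedExternalDifferences G B nonempty

    s : Carrier → ℕ
    s z = ∑[ i ∈ F ] μ z (members (B i))

    -- `s (g ∙ y)` is 1 unless `g ∙ y` is `ε`, that is, unless `y` is `g ⁻¹`; the second summand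
    -- supplies the 1 missing there.
    block : ∀ M → ∑[ y ∈ M ] s (g ∙ y) + μ (g ⁻¹) M ≡ length M
    block M = begin
      ∑[ y ∈ M ] s (g ∙ y) + μ (g ⁻¹) M
        ≡⟨ cong (∑[ y ∈ M ] s (g ∙ y) +_) (trans (μ≡∑ (g ⁻¹) M) (∑-cong M λ y →
             𝟙-⇔ ((g ⁻¹) ≟ y) ((g ∙ y) ≟ ε) (λ { refl → inverseʳ g }) (sym ∘ inverseʳ-unique g y))) ⟩
      ∑[ y ∈ M ] s (g ∙ y) + ∑[ y ∈ M ] 𝟙 ((g ∙ y) ≟ ε)
        ≡⟨ ∑-distrib-+ M _ _ ⟨
      ∑[ y ∈ M ] (s (g ∙ y) + 𝟙 ((g ∙ y) ≟ ε))
        ≡⟨ ∑-one M (λ {y} _ → near-complete (g ∙ y)) ⟩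
      length M ∎

  -- At g = ε the terms w j * ρ (B j) ε = w j * ∣ B j ∣ already exhaust the right-hand side.
  near-complete-μ-ε : ∀ {m} (B : Family Carrier m) (nonempty : ∀ i → NonZero ∣ B i ∣) →
    (∀ z → ∑[ i ∈ allFin m ] μ z (members (B i)) + 𝟙 (z ≟ ε) ≡ 1) →
    μ ε (weightedExternalDifferences G B nonempty) ≡ 0
  near-complete-μ-ε {m} B nonempty near-complete = m+n≡0⇒m≡0 (μ ε wed) (+-cancelʳ-≡ total _ _ (begin
    μ ε wed + rest + total
      ≡⟨ +-assoc (μ ε wed) rest total ⟩
    μ ε wed + (rest + total)
      ≡⟨ cong (μ ε wed +_) (+-comm rest total) ⟩
    μ ε wed + (total + rest)
      ≡⟨ cong (μ ε wed +_) (∑-distrib-+ F _ _) ⟨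
    μ ε wed + ∑[ j ∈ F ] (w j * ∣ B j ∣ + w j * μ (ε ⁻¹) (members (B j)))
      ≡⟨ cong (μ ε wed +_) (∑-cong F λ j → trans (sym (*-distribˡ-+ (w j) _ _))
           (cong (λ n → w j * (n + μ (ε ⁻¹) (members (B j)))) (sym (ρ-ε (B j))))) ⟩
    μ ε wed + ∑[ j ∈ F ] (w j * (ρ (B j) ε + μ (ε ⁻¹) (members (B j))))
      ≡⟨ near-complete-μ B nonempty near-complete ε ⟩
    total ∎))
    where
    F     = allFin m
    w     = weight B nonempty
    wed   = weightedExternalDifferences G B nonempty
    total = ∑[ j ∈ F ] (w j * ∣ B j ∣)
    rest  = ∑[ j ∈ F ] (w j * μ (ε ⁻¹) (members (B j)))

++-pairwiseDisjoint : ∀ {m n} (B : Family A m) (C : Family A n) →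
  PairwiseDisjoint B → PairwiseDisjoint C → (∀ i j x → ¬ (x ∈ₛ B i × x ∈ₛ C j)) →
  PairwiseDisjoint (B ++ C)
++-pairwiseDisjoint {m = m} B C disjB disjC disjBC i j i≢j x (x∈i , x∈j)
  with splitAt m i in eqi | splitAt m j in eqj
... | inj₁ a | inj₁ b = disjB a b
  (λ { refl → i≢j (trans (sym (splitAt⁻¹-↑ˡ eqi)) (splitAt⁻¹-↑ˡ eqj)) }) x (x∈i , x∈j)
... | inj₁ a | inj₂ b = disjBC a b x (x∈i , x∈j)
... | inj₂ a | inj₁ b = disjBC b a x (x∈j , x∈i)
... | inj₂ a | inj₂ b = disjC a b
  (λ { refl → i≢j (trans (sym (splitAt⁻¹-↑ʳ eqi)) (splitAt⁻¹-↑ʳ eqj)) }) x (x∈i , x∈j)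

-- Residue classes

toℕ-mod : ∀ a d .{{_ : NonZero d}} → toℕ (a mod d) ≡ a % d
toℕ-mod a d = toℕ-fromℕ< (m%n<n a d)

mod≡⇒ : ∀ {a d} .{{_ : NonZero d}} (x : Fin d) → a % d ≡ toℕ x % d → a mod d ≡ x
mod≡⇒ {a} {d} x eq = toℕ-injective (trans (toℕ-mod a d) (trans eq (m<n⇒m%n≡m (toℕ<n x))))

mod-toℕ : ∀ {d} .{{_ : NonZero d}} (x : Fin d) → toℕ x mod d ≡ x
mod-toℕ x = mod≡⇒ x refl

-- The left side is the operation of `ℤmod d` unfolded at the classes of 1 and `j`; this is the
-- induction step for multiples of the generator.
mod-suc : ∀ j d .{{_ : NonZero d}} → (toℕ (1 mod d) + toℕ (j mod d)) mod d ≡ suc j mod d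
mod-suc j d = toℕ-injective (begin
  toℕ ((toℕ (1 mod d) + toℕ (j mod d)) mod d)  ≡⟨ toℕ-mod _ d ⟩
  (toℕ (1 mod d) + toℕ (j mod d)) % d          ≡⟨ cong₂ (λ a b → (a + b) % d) (toℕ-mod 1 d) (toℕ-mod j d) ⟩
  (1 % d + j % d) % d                          ≡⟨ %-distribˡ-+ 1 j d ⟨
  suc j % d                                    ≡⟨ toℕ-mod (suc j) d ⟨
  toℕ (suc j mod d)                            ∎)

-- By the hypothesis `x * a` is 0 modulo `a` and 1 modulo `b`, so adding multiples of it to `u`
-- adjusts the residue modulo `b` alone.
bézout⇒crt : ∀ a b .{{_ : NonZero a}} .{{_ : NonZero b}} x y → 1 + y * b ≡ x * a →
  ∀ u v → ∃ λ j → j % a ≡ u % a × j % b ≡ v % b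
bézout⇒crt a b@(suc b′) x y eq u v = j , mod-a , mod-b
  where
  open +-*-Solver

  -- The required multiplier is `v - u` modulo `b`; as `b′` is `b - 1`, hence -1 modulo `b`, the
  -- product `b′ * u` stands in for the negative of `u`.
  j = u + x * a * (v + b′ * u)

  mod-a : j % a ≡ u % a
  mod-a = trans
    (cong (_% a) (solve 4 (λ u x a w → u :+ x :* a :* w := u :+ (x :* w) :* a) refl u x a (v + b′ * u)))
    ([m+kn]%n≡m%n u (x * (v + b′ * u)) a)

  mod-b : j % b ≡ v % b
  mod-b = trans
    (cong (_% b) (trans
      (cong (λ e → u + e * (v + b′ * u)) (sym eq))
      (solve 4 (λ u v y b′ →
        u :+ (con 1 :+ y :* (con 1 :+ b′)) :* (v :+ b′ :* u)
          := v :+ (u :+ y :* (v :+ b′ :* u)) :* (con 1 :+ b′)) refl u v y b′)))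
    ([m+kn]%n≡m%n v (u + y * (v + b′ * u)) b)

crt : ∀ a b .{{_ : NonZero a}} .{{_ : NonZero b}} → gcd a b ≡ 1 →
  ∀ u v → ∃ λ j → j % a ≡ u % a × j % b ≡ v % b
crt a b gcd≡1 u v with coprime-Bézout (gcd≡1⇒coprime gcd≡1)
... | Bézout.+- x y eq = bézout⇒crt a b x y eq u v
-- The opposite sign in the Bézout identity is the first case with the two moduli exchanged.
... | Bézout.-+ x y eq with j , mod-b , mod-a ← bézout⇒crt b a y x eq v u = j , mod-a , mod-b

-- The generator is the class of `(1 , 1)`: its `j`-th multiple is the class of `(j , j)`, and the
-- Chinese remainder theorem finds a `j` for every element.
ambientGroup-cyclic : ∀ k t (2≤k : 2 ≤ k) → gcd (k ∸ 1) (t * k + 1) ≡ 1 → IsCyclic (ambientGroup k t 2≤k)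
ambientGroup-cyclic k t 2≤k gcd≡1 = class k t 2≤k 1 1 , multiple
  where
  open FiniteAbelianGroup (ambientGroup k t 2≤k) using (abelianGroup)
  open RawMonoidDefinitions (AbelianGroup.rawMonoid abelianGroup) using () renaming (_×_ to _×ᴳ_)

  instance
    _ : NonZero (k ∸ 1)
    _ = >-nonZero (∸-monoˡ-≤ 1 2≤k)

    _ : NonZero (t * k + 1)
    _ = >-nonZero (m≤n+m 1 (t * k))

  ×-class : ∀ j → j ×ᴳ class k t 2≤k 1 1 ≡ class k t 2≤k j j
  ×-class zero    = refl
  ×-class (suc j) rewrite ×-class j = cong₂ _,_ (mod-suc j (k ∸ 1)) (mod-suc j (t * k + 1))

  multiple : ∀ x → ∃ λ j → j ×ᴳ class k t 2≤k 1 1 ≡ x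
  multiple (u , v) with j , mod-a , mod-b ← crt (k ∸ 1) (t * k + 1) gcd≡1 (toℕ u) (toℕ v) =
    j , trans (×-class j) (cong₂ _,_ (mod≡⇒ u mod-a) (mod≡⇒ v mod-b))

-- The construction

-- With `k = q + 2` and `t = p + 1` the differences `k ∸ 1` and `k ∸ 2` compute to `suc q` and `q`,
-- so the polynomial identities contain no subtraction.
module Construction (q p : ℕ) (2≤k : 2 ≤ suc (suc q)) where

  k t s n : ℕ
  k = suc (suc q)
  t = suc p
  s = t * (k ∸ 1)
  n = (k ∸ 1) * (t * k + 1)

  G : FiniteAbelianGroup
  G = ambientGroup k t 2≤k

  open FiniteAbelianGroup G
  open Multiplicity G
  open AbelianGroupProperties abelianGroup using (⁻¹-involutive; ε⁻¹≈ε)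

  instance
    tk+1-nonZero : NonZero (t * k + 1)
    tk+1-nonZero = >-nonZero (m≤n+m 1 (t * k))

  module ℤ₂ = FiniteAbelianGroup (ℤmod (t * k + 1))
  module ℤ₂ᴬ = AbelianGroup ℤ₂.abelianGroup

  λ-value : ℕ
  λ-value = (t + 1) * k ^ 2 ∸ (t + 3) * k

  -- The bracket is `(t + 1) * k - (t + 3)` expanded in `p` and `q`. All its terms are nonnegative,
  -- so the truncated subtraction is a true one.
  λ-value≡ : λ-value ≡ k * (p * q + 2 * q + p)
  λ-value≡ = begin
    (t + 1) * k ^ 2 ∸ (t + 3) * k                            ≡⟨ cong (_∸ (t + 3) * k) (solve 2 (λ p q →
      (con 1 :+ p :+ con 1) :* ((con 2 :+ q) :^ 2) :=
      (con 2 :+ q) :* (p :* q :+ con 2 :* q :+ p) :+ (con 1 :+ p :+ con 3) :* (con 2 :+ q)) refl p q) ⟩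
    k * (p * q + 2 * q + p) + (t + 3) * k ∸ (t + 3) * k      ≡⟨ m+n∸n≡m _ ((t + 3) * k) ⟩
    k * (p * q + 2 * q + p)                                  ∎
    where open +-*-Solver

  -- The bracket vanishes only for `p = q = 0`, and then `s + q` is 1, contrary to the bound.
  λ-positive : 2 ≤ s + q → 0 < λ-value
  λ-positive 2≤s+q = subst (0 <_) (sym λ-value≡) (positive p q 2≤s+q)
    where
    positive : ∀ p q → 2 ≤ suc p * suc q + q → 0 < suc (suc q) * (p * q + 2 * q + p)
    positive zero    zero    (s≤s ())
    positive (suc p) zero    _ rewrite +-comm (p * 0 + 0) (suc p) = s≤s z≤n
    positive zero    (suc q) _ = s≤s z≤n
    positive (suc p) (suc q) _ = s≤s z≤n

  module _
    (R : Family Carrier (s + 1))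
    (R-pdf : IsPDF G n (replicate s k ++ replicate 1 (k ∸ 1)) (k ∸ 1) R)
    (H-firstFactor : IsFirstFactor k t 2≤k (R (s ↑ʳ zero)))
    where
    private module R = IsPDF R-pdf

    -- The block that `V` drops. Its elements other than `ε` return as the singletons `S`, while `P`
    -- keeps the blocks of size `k`.
    H : Subset Carrier
    H = R (s ↑ʳ zero)

    P : Family Carrier s
    P = Vector.take s R

    S : Family Carrier q
    S j = ⁅ class k t 2≤k (suc (toℕ j)) 0 ⁆

    V : Family Carrier (s + q)
    V = familyV k t 2≤k R

    ∣P∣≡k : ∀ i → ∣ P i ∣ ≡ k
    ∣P∣≡k i = trans (R.sizes (i ↑ˡ 1)) (lookup-++ˡ (replicate s k) (replicate 1 (k ∸ 1)) i)

    ∣H∣≡k-1 : ∣ H ∣ ≡ k ∸ 1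
    ∣H∣≡k-1 = trans (R.sizes (s ↑ʳ zero)) (lookup-++ʳ (replicate s k) (replicate 1 (k ∸ 1)) zero)

    V-sizes : Vector.map ∣_∣ V ≗ replicate s k ++ replicate q 1
    V-sizes i with splitAt s i
    ... | inj₁ a = ∣P∣≡k a
    ... | inj₂ _ = refl

    V-nonempty : ∀ i → NonZero ∣ V i ∣
    V-nonempty i with splitAt s i
    ... | inj₁ a = R.nonempty (a ↑ˡ 1)
    ... | inj₂ _ = _

    0ˢ : Fin (t * k + 1)
    0ˢ = 0 mod (t * k + 1)

    -- The first coordinates 1, ..., `q` lie below the modulus `k ∸ 1`, which is `suc q`, so none of
    -- them wraps around.
    class-suc-injective : ∀ i j → class k t 2≤k (suc (toℕ {q} i)) 0 ≡ class k t 2≤k (suc (toℕ {q} j)) 0 → i ≡ j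
    class-suc-injective i j eq =
      Finₚ.suc-injective (trans (sym (mod-toℕ (suc i))) (trans (cong proj₁ eq) (mod-toℕ (suc j))))

    -- Every singleton lies in `H`, which meets no block of `P`.
    V-disjoint : PairwiseDisjoint V
    V-disjoint = ++-pairwiseDisjoint P S
      (λ i j i≢j → R.disjoint (i ↑ˡ 1) (j ↑ˡ 1) (i≢j ∘ ↑ˡ-injective 1 i j))
      (λ { i j i≢j _ (here refl , here eq) → i≢j (class-suc-injective i j eq) })
      (λ { i j x (x∈Pi , here refl) → R.disjoint (i ↑ˡ 1) (s ↑ʳ zero) (↑ˡ≢↑ʳ i) x
             (x∈Pi , Equivalence.from (H-firstFactor x) refl) })
      where
      ↑ˡ≢↑ʳ : ∀ i → i ↑ˡ 1 ≢ s ↑ʳ zero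
      ↑ˡ≢↑ʳ i eq with () ← trans (sym (splitAt-↑ˡ s i 1)) (trans (cong (splitAt s) eq) (splitAt-↑ʳ s 1 zero))

    -- Sizes, weights and sums over the blocks

    ∑R : ∀ (F : Subset Carrier → ℕ) → ∑[ i ∈ allFin (s + 1) ] F (R i) ≡ ∑[ i ∈ allFin s ] F (P i) + F H
    ∑R F = trans (∑-splitAt s (F ∘ R)) (cong (∑ (allFin s) (F ∘ P) +_) (+-identityʳ (F H)))

    -- The summand receives the index besides the block, because weights are attached to indices.
    ∑V : ∀ (f : Fin (s + q) → Subset Carrier → ℕ) → ∑[ i ∈ allFin (s + q) ] f i (V i)
      ≡ ∑[ i ∈ allFin s ] f (i ↑ˡ q) (P i) + ∑[ j ∈ allFin q ] f (s ↑ʳ j) (S j)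
    ∑V f = trans (∑-splitAt s (λ i → f i (V i))) (cong₂ _+_
      (∑-cong (allFin s) λ i → cong (f (i ↑ˡ q)) (lookup-++ˡ P S i))
      (∑-cong (allFin q) λ j → cong (f (s ↑ʳ j)) (lookup-++ʳ P S j)))

    V-total : Vector.foldr _+_ 0 (Vector.map ∣_∣ V) ≡ n ∸ 1
    V-total = begin
      Vector.foldr _+_ 0 (Vector.map ∣_∣ V)                            ≡⟨ foldr-+≡∑ (Vector.map ∣_∣ V) ⟩
      ∑[ i ∈ allFin (s + q) ] ∣ V i ∣                                  ≡⟨ ∑V (λ _ → ∣_∣) ⟩
      ∑[ i ∈ allFin s ] ∣ P i ∣ + ∑[ j ∈ allFin q ] 1
        ≡⟨ cong₂ _+_ (trans (∑-cong (allFin s) ∣P∣≡k) (∑-allFin-const s k)) (∑-allFin-const q 1) ⟩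
      -- The added 1 accounts for `ε`, the one element outside all blocks; with it the total is
      -- exactly `n`.
      s * k + q * 1                                                    ≡⟨ m+n∸n≡m (s * k + q * 1) 1 ⟨
      s * k + q * 1 + 1 ∸ 1                                            ≡⟨ cong (_∸ 1) (solve 2 (λ p q →
        (con 1 :+ p) :* (con 1 :+ q) :* (con 2 :+ q) :+ q :* con 1 :+ con 1 :=
        (con 1 :+ q) :* ((con 1 :+ p) :* (con 2 :+ q) :+ con 1)) refl p q) ⟩
      n ∸ 1                                                            ∎
      where open +-*-Solver

    -- The sizes are `k` and 1, and `k` does occur: `s` is a product of two successors, so `P` has a
    -- block with index `zero`.
    V-lcm : lcmSizes G V ≡ k
    V-lcm = foldr-lcm≡ (Vector.map ∣_∣ V) (λ i → subst (_∣ k) (sym (V-sizes i)) (divides-k i))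
      (zero ↑ˡ q) (trans (V-sizes (zero ↑ˡ q)) (lookup-++ˡ (replicate s k) (replicate q 1) zero))
      where
      divides-k : ∀ i → (replicate s k ++ replicate q 1) i ∣ k
      divides-k i with splitAt s i
      ... | inj₁ _ = ∣-refl
      ... | inj₂ _ = 1∣ k

    w : Fin (s + q) → ℕ
    w = weight V V-nonempty

    w≡k/ : ∀ i {a} .{{_ : NonZero a}} → ∣ V i ∣ ≡ a → w i ≡ k / a
    w≡k/ i eq = trans
      (/-congˡ {o = ∣ V i ∣} {{V-nonempty i}} V-lcm) (/-congʳ {{V-nonempty i}} eq)

    w-P : ∀ i → w (i ↑ˡ q) ≡ 1
    w-P i = trans
      (w≡k/ (i ↑ˡ q) (trans (V-sizes (i ↑ˡ q)) (lookup-++ˡ (replicate s k) (replicate q 1) i))) (n/n≡1 k)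

    w-S : ∀ j → w (s ↑ʳ j) ≡ k
    w-S j = trans
      (w≡k/ (s ↑ʳ j) (trans (V-sizes (s ↑ʳ j)) (lookup-++ʳ (replicate s k) (replicate q 1) j))) (n/1≡n k)

    -- A block of size `k` has weight `k / k`, a singleton has weight `k / 1`.
    ∑wV : ∀ (F : Subset Carrier → ℕ) → ∑[ i ∈ allFin (s + q) ] (w i * F (V i))
      ≡ ∑[ i ∈ allFin s ] F (P i) + k * ∑[ j ∈ allFin q ] F (S j)
    ∑wV F = trans (∑V (λ i B → w i * F B)) (cong₂ _+_
      (∑-cong (allFin s) λ i → trans (cong (_* F (P i)) (w-P i)) (*-identityˡ _))
      (trans (∑-cong (allFin q) λ j → cong (_* F (S j)) (w-S j)) (sym (*-distribˡ-∑ k (allFin q) (F ∘ S)))))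

    V-weighted-total : ∑[ i ∈ allFin (s + q) ] (w i * ∣ V i ∣) ≡ λ-value + k
    V-weighted-total = begin
      ∑[ i ∈ allFin (s + q) ] (w i * ∣ V i ∣)               ≡⟨ ∑wV ∣_∣ ⟩
      ∑[ i ∈ allFin s ] ∣ P i ∣ + k * ∑[ j ∈ allFin q ] 1
        ≡⟨ cong₂ (λ a b → a + k * b)
             (trans (∑-cong (allFin s) ∣P∣≡k) (∑-allFin-const s k)) (∑-allFin-const q 1) ⟩
      s * k + k * (q * 1)                                   ≡⟨ solve 2 (λ p q →
        (con 1 :+ p) :* (con 1 :+ q) :* (con 2 :+ q) :+ (con 2 :+ q) :* (q :* con 1) :=
        (con 2 :+ q) :* (p :* q :+ con 2 :* q :+ p) :+ (con 2 :+ q)) refl p q ⟩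
      k * (p * q + 2 * q + p) + k                           ≡⟨ cong (_+ k) λ-value≡ ⟨
      λ-value + k                                           ∎
      where open +-*-Solver

    -- Counting in the subgroup and in the two kinds of blocks

    μ-H : ∀ z → μ z (members H) ≡ 𝟙 (proj₂ z Finₚ.≟ 0ˢ)
    μ-H z with proj₂ z Finₚ.≟ 0ˢ
    ... | yes eq = μ-∈ (Subset.unique H) (Equivalence.from (H-firstFactor z) eq)
    ... | no ≢0  = μ-∉ (≢0 ∘ Equivalence.to (H-firstFactor z))

    μ-H-cong : ∀ x y → (proj₂ x ≡ 0ˢ → proj₂ y ≡ 0ˢ) → (proj₂ y ≡ 0ˢ → proj₂ x ≡ 0ˢ) →
      μ x (members H) ≡ μ y (members H)
    μ-H-cong x y to from = trans (μ-H x) (trans (𝟙-⇔ (_ Finₚ.≟ _) (_ Finₚ.≟ _) to from) (sym (μ-H y)))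

    μ-H-⁻¹ : ∀ g → μ g (members H) ≡ μ (g ⁻¹) (members H)
    μ-H-⁻¹ g = μ-H-cong g (g ⁻¹) (inv (proj₂ g)) (λ eq →
      trans (sym (cong proj₂ (⁻¹-involutive g))) (inv (proj₂ (g ⁻¹)) eq))
      where
      inv : ∀ x → x ≡ 0ˢ → x ℤ₂.⁻¹ ≡ 0ˢ
      inv x refl = cong proj₂ ε⁻¹≈ε

    -- `H` is a subgroup, so translating by `y` in `H` does not affect membership of `g` in `H`; all
    -- `k ∸ 1` summands agree.
    ρ-H : ∀ g → ρ H g ≡ (k ∸ 1) * μ g (members H)
    ρ-H g = begin
      ∑[ y ∈ members H ] μ (g ∙ y) (members H)  ≡⟨ ∑-cong∈ (members H) (λ {y} y∈H →
        let +y = shift-0 y (Equivalence.to (H-firstFactor y) y∈H) in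
        μ-H-cong (g ∙ y) g (trans (sym +y)) (trans +y)) ⟩
      ∑[ _ ∈ members H ] μ g (members H)        ≡⟨ ∑-const (members H) _ ⟩
      ∣ H ∣ * μ g (members H)                   ≡⟨ cong (_* μ g (members H)) ∣H∣≡k-1 ⟩
      (k ∸ 1) * μ g (members H)                 ∎
      where
      shift-0 : ∀ y → proj₂ y ≡ 0ˢ → proj₂ (g ∙ y) ≡ proj₂ g
      shift-0 y eq = trans (cong (proj₂ g ℤ₂.∙_) eq) (ℤ₂ᴬ.identityʳ (proj₂ g))

    -- The singletons exhaust `H` apart from `ε`, which the indicator contributes.
    ∑μ-S : ∀ z → ∑[ j ∈ allFin q ] μ z (members (S j)) + 𝟙 (z ≟ ε) ≡ μ z (members H)
    ∑μ-S z = begin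
      ∑[ j ∈ allFin q ] μ z (members (S j)) + 𝟙 (z ≟ ε)
        ≡⟨ +-comm _ (𝟙 (z ≟ ε)) ⟩
      𝟙 (z ≟ ε) + ∑[ j ∈ allFin q ] μ z (members (S j))
        ≡⟨ cong (𝟙 (z ≟ ε) +_) (∑-cong (allFin q) λ j → trans (μ≡∑ z (members (S j))) (+-identityʳ _)) ⟩
      𝟙 (z ≟ ε) + ∑[ j ∈ allFin q ] 𝟙 (z ≟ class k t 2≤k (suc (toℕ j)) 0)
        -- `ε` is the class of `(0 , 0)`, so its indicator is the missing term at index 0, and the
        -- index now runs through all residues modulo `k ∸ 1`.
        ≡⟨ ∑-suc {q} (λ j → 𝟙 (z ≟ class k t 2≤k (toℕ j) 0)) ⟨
      ∑[ j ∈ allFin (suc q) ] 𝟙 (z ≟ class k t 2≤k (toℕ j) 0)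
        -- Only the index equal to the first coordinate of `z` can contribute.
        ≡⟨ ∑-single (allFin⁺ (suc q)) (∈-allFin (proj₁ z)) (λ {j} j≢z →
             𝟙-no (z ≟ class k t 2≤k (toℕ j) 0) λ { refl → j≢z (sym (mod-toℕ j)) }) ⟩
      𝟙 (z ≟ class k t 2≤k (toℕ (proj₁ z)) 0)
        ≡⟨ 𝟙-⇔ (z ≟ _) (proj₂ z Finₚ.≟ 0ˢ) (cong proj₂) (cong₂ _,_ (sym (mod-toℕ (proj₁ z)))) ⟩
      𝟙 (proj₂ z Finₚ.≟ 0ˢ)
        ≡⟨ μ-H z ⟨
      μ z (members H) ∎

    ∑μ-P : ∀ z → ∑[ i ∈ allFin s ] μ z (members (P i)) + μ z (members H) ≡ 1
    ∑μ-P z = trans (sym (∑R (μ z ∘ members))) (partition-μ R R.disjoint R.covers z)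

    -- The difference condition of the PDF, with the share of `H` split off.
    ∑ρ-P : ∀ {g} → g ≢ ε → ∑[ i ∈ allFin s ] ρ (P i) g + ρ H g ≡ k ∸ 1
    ∑ρ-P {g} g≢ε = begin
      ∑[ i ∈ allFin s ] ρ (P i) g + ρ H g
        ≡⟨ ∑R (λ B → ρ B g) ⟨
      ∑[ i ∈ allFin (s + 1) ] ρ (R i) g
        ≡⟨ ∑-cong (allFin (s + 1)) (λ i → μ-internalDifferences (R i) g≢ε) ⟨
      ∑[ i ∈ allFin (s + 1) ] μ g (internalDifferences G (R i))
        ≡⟨ μ-concat-tabulate g (λ i → internalDifferences G (R i)) ⟨
      μ g (List.concat (tabulate (λ i → internalDifferences G (R i))))
        ≡⟨ R.differences g g≢ε ⟩
      k ∸ 1 ∎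

    -- `P` covers the complement of `H`, and `S` together with `ε` covers `H`.
    V-near-complete : ∀ z → ∑[ i ∈ allFin (s + q) ] μ z (members (V i)) + 𝟙 (z ≟ ε) ≡ 1
    V-near-complete z = begin
      ∑[ i ∈ allFin (s + q) ] μ z (members (V i)) + 𝟙 (z ≟ ε)
        ≡⟨ cong (_+ 𝟙 (z ≟ ε)) (∑V (λ _ → μ z ∘ members)) ⟩
      ∑[ i ∈ allFin s ] μ z (members (P i)) + ∑[ j ∈ allFin q ] μ z (members (S j)) + 𝟙 (z ≟ ε)
        ≡⟨ +-assoc (∑[ i ∈ allFin s ] μ z (members (P i))) _ _ ⟩
      ∑[ i ∈ allFin s ] μ z (members (P i)) + (∑[ j ∈ allFin q ] μ z (members (S j)) + 𝟙 (z ≟ ε))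
        ≡⟨ cong (∑[ i ∈ allFin s ] μ z (members (P i)) +_) (∑μ-S z) ⟩
      ∑[ i ∈ allFin s ] μ z (members (P i)) + μ z (members H)
        ≡⟨ ∑μ-P z ⟩
      1 ∎

    -- The two terms depending on whether g lies in H cancel: the weight k of the singleton
    -- containing - g balances the k - 1 differences that H contributes to the PDF.
    V-correction : ∀ {g} → g ≢ ε →
      ∑[ i ∈ allFin (s + q) ] (w i * (ρ (V i) g + μ (g ⁻¹) (members (V i)))) ≡ k
    V-correction {g} g≢ε = begin
      ∑[ i ∈ allFin (s + q) ] (w i * (ρ (V i) g + μ (g ⁻¹) (members (V i))))
        ≡⟨ ∑wV (λ B → ρ B g + μ (g ⁻¹) (members B)) ⟩
      ∑[ i ∈ allFin s ] (ρ (P i) g + μ (g ⁻¹) (members (P i)))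
        + k * ∑[ j ∈ allFin q ] (ρ (S j) g + μ (g ⁻¹) (members (S j)))
        ≡⟨ cong₂ (λ a b → a + k * b) (∑-distrib-+ (allFin s) (λ i → ρ (P i) g) _) (∑-cong (allFin q) λ j →
             cong (_+ μ (g ⁻¹) (members (S j))) (ρ-singleton (class k t 2≤k (suc (toℕ j)) 0) g≢ε)) ⟩
      a + b + k * ∑[ j ∈ allFin q ] μ (g ⁻¹) (members (S j))
        ≡⟨ cong (λ c → a + b + k * c) ∑μ-S≡h ⟩
      a + b + k * h
        -- `k * h` splits into `(k ∸ 1) * h`, which completes the PDF count, and `h`, which
        -- completes the partition count at `g ⁻¹`.
        ≡⟨ solve 4 (λ a b h q →
             a :+ b :+ (con 2 :+ q) :* h := (a :+ (con 1 :+ q) :* h) :+ (b :+ h)) refl a b h q ⟩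
      (a + (k ∸ 1) * h) + (b + h)
        ≡⟨ cong₂ _+_ (trans (cong (a +_) (sym ρ-H≡)) (∑ρ-P g≢ε)) (∑μ-P (g ⁻¹)) ⟩
      (k ∸ 1) + 1
        ≡⟨ +-comm (k ∸ 1) 1 ⟩
      k ∎
      where
      open +-*-Solver

      a = ∑[ i ∈ allFin s ] ρ (P i) g
      b = ∑[ i ∈ allFin s ] μ (g ⁻¹) (members (P i))
      h = μ (g ⁻¹) (members H)

      ρ-H≡ : ρ H g ≡ (k ∸ 1) * h
      ρ-H≡ = trans (ρ-H g) (cong ((k ∸ 1) *_) (μ-H-⁻¹ g))

      g⁻¹≢ε : g ⁻¹ ≢ ε
      g⁻¹≢ε eq = g≢ε (trans (sym (⁻¹-involutive g)) (trans (cong _⁻¹ eq) ε⁻¹≈ε))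

      ∑μ-S≡h : ∑[ j ∈ allFin q ] μ (g ⁻¹) (members (S j)) ≡ h
      ∑μ-S≡h = begin
        c                     ≡⟨ +-identityʳ c ⟨
        c + 0                 ≡⟨ cong (c +_) (𝟙-no ((g ⁻¹) ≟ ε) g⁻¹≢ε) ⟨
        c + 𝟙 ((g ⁻¹) ≟ ε)    ≡⟨ ∑μ-S (g ⁻¹) ⟩
        h                     ∎
        where c = ∑[ j ∈ allFin q ] μ (g ⁻¹) (members (S j))

    -- Multiplicities are compared element by element: both sides are 0 at `ε`, and both are
    -- `λ-value` elsewhere.
    V-differences : weightedExternalDifferences G V V-nonempty ↭ λ-value ⊠ nonzeroElements G
    V-differences = equal-μ⇒↭ _ _ λ g → trans (μ-wed g) (sym (μ-⊠ g λ-value (nonzeroElements G)))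
      where
      wed = weightedExternalDifferences G V V-nonempty

      μ-wed : ∀ g → μ g wed ≡ λ-value * μ g (nonzeroElements G)
      μ-wed g with g ≟ ε
      ... | yes refl = begin
        μ ε wed                              ≡⟨ near-complete-μ-ε V V-nonempty V-near-complete ⟩
        0                                    ≡⟨ *-zeroʳ λ-value ⟨
        λ-value * 0                          ≡⟨ cong (λ-value *_) μ-nonzeroElements-ε ⟨
        λ-value * μ ε (nonzeroElements G)    ∎
      ... | no g≢ε = begin
        -- For `g ≢ ε` the correction is the constant `k` and the weighted total is `λ-value + k`,
        -- so cancelling `k` leaves `λ-value`.
        μ g wed                              ≡⟨ +-cancelʳ-≡ k _ _ (begin
          μ g wed + k                                           ≡⟨ cong (μ g wed +_) (V-correction g≢ε) ⟨
          μ g wed + ∑[ i ∈ allFin (s + q) ] (w i * (ρ (V i) g + μ (g ⁻¹) (members (V i))))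
            ≡⟨ near-complete-μ V V-nonempty V-near-complete g ⟩
          ∑[ i ∈ allFin (s + q) ] (w i * ∣ V i ∣)               ≡⟨ V-weighted-total ⟩
          λ-value + k                                           ∎) ⟩
        λ-value                              ≡⟨ *-identityʳ λ-value ⟨
        λ-value * 1                          ≡⟨ cong (λ-value *_) (μ-nonzeroElements g≢ε) ⟨
        λ-value * μ g (nonzeroElements G)    ∎

    V-isSWEDF : 2 ≤ s + q →
      IsSWEDF G n (s + q) (replicate s k ++ replicate q 1) (n ∸ 1) λ-value V
    V-isSWEDF 2≤s+q = record
      { order-n     = R.order-n
      ; nonempty    = V-nonempty
      ; disjoint    = V-disjoint
      ; sizes       = V-sizes
      ; total       = V-total
      ; ℓ-positive  = λ-positive 2≤s+q
      ; differences = V-differences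
      }

theorem6 : (k t : ℕ) (2≤k : 2 ≤ k) → 1 ≤ t →
    gcd (k ∸ 1) (t * k + 1) ≡ 1 →
    2 ≤ t * (k ∸ 1) + (k ∸ 2) →
    let n = (k ∸ 1) * (t * k + 1)
        G = ambientGroup k t 2≤k
    in
    (R : Family (FiniteAbelianGroup.Carrier G) (t * (k ∸ 1) + 1)) →
    IsPDF G n (replicate (t * (k ∸ 1)) k ++ replicate 1 (k ∸ 1)) (k ∸ 1) R →
    IsFirstFactor k t 2≤k (R ((t * (k ∸ 1)) ↑ʳ zero)) →
    IsCyclicSWEDF G n (t * (k ∸ 1) + (k ∸ 2))
      (replicate (t * (k ∸ 1)) k ++ replicate (k ∸ 2) 1)
      (n ∸ 1)
      ((t + 1) * k ^ 2 ∸ (t + 3) * k)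
      (familyV k t 2≤k R)
-- The bounds on `k` and `t` leave only `k = q + 2` and `t = p + 1`.
theorem6 zero          t       () _ _ _ _ _ _
theorem6 (suc zero)    t       (s≤s ()) _ _ _ _ _ _
theorem6 (suc (suc q)) zero    _ () _ _ _ _ _
theorem6 (suc (suc q)) (suc p) 2≤k _ gcd≡1 2≤m R R-pdf H-firstFactor =
  ambientGroup-cyclic (suc (suc q)) (suc p) 2≤k gcd≡1 ,
  Construction.V-isSWEDF q p 2≤k R R-pdf H-firstFactor 2≤m
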